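{- Let $G=G(V,E)$ be a comparability graph. Then the vertices of the graphical zonotope $\mathcal{Z}_G$ that have maximal Euclidean distance to the origin are precisely those that correspond to the transitive orientations of $E$, which in turn have the maximal number $\varepsilon(G)$ of linear extensions.
   Context: A comparability graph is a simple graph $G=G(V,E)$ such that there is a partial order on $V$ under which distinct $u,v$ are comparable iff $\{u,v\}\in E$. An acyclic orientation of $E$ is transitive if the comparability graph of the partial order it induces ($u<v$ iff there is a directed path from $u$ to $v$) is exactly $G$. The graphical zonotope is $\mathcal{Z}_G=\sum_{\{i,j\}\in E}[e_i-e_j,e_j-e_i]\subseteq\mathbb{R}^V$ (Minkowski sum of segments); its vertices correspond bijectively to acyclic orientations of $E$, the vertex corresponding to an acyclic orientation being $(\mathrm{outdeg}(v)-\mathrm{indeg}(v))_{v\in V}$, with degrees computed in that orientation. $\varepsilon(G)$ is the maximum over acyclic orientations of $E$ of the number of linear extensions (bijections $f:V\to[|V|]$ with $f(u)<f(v)$ whenever $u<v$) of the induced partial order. -}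

module Defs where

open import Level using (0ℓ)
open import Data.Bool using (Bool; true; false; not; if_then_else_)
open import Data.Nat using (ℕ; zero; suc; _+_; _^_; _≤_; ∣_-_∣)
open import Data.Fin using (Fin) renaming (_<_ to _<ᶠ_)
open import Data.Vec using (Vec; lookup)
open import Data.List using (List; length; map; allFin)
open import Data.Nat.ListAction using (sum)
open import Data.Empty using (⊥)
open import Data.List.Membership.Propositional using (_∈_)
open import Data.List.Relation.Unary.Unique.Propositional using (Unique)
open import Data.Product using (Σ; ∃; _×_)
open import Data.Sum using (_⊎_)
open import Function.Bundles using (_⇔_)
open import Relation.Binary.Core using (Rel)
open import Relation.Binary.Structures using (IsStrictPartialOrder)
open import Relation.Binary.PropositionalEquality using (_≡_; _≢_)
open import Relation.Binary.Construct.Closure.Transitive using (TransClosure)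

record Graph (n : ℕ) : Set where
  field
    adj   : Fin n → Fin n → Bool
    sym   : ∀ u v → adj u v ≡ adj v u
    irrefl : ∀ u → adj u u ≡ false
open Graph public

Edge : ∀ {n} → Graph n → Fin n → Fin n → Set
Edge G u v = adj G u v ≡ true

IsComparabilityGraph : ∀ {n} → Graph n → Set₁
IsComparabilityGraph {n} G =
  Σ (Rel (Fin n) 0ℓ) λ R →
    IsStrictPartialOrder _≡_ R ×
    (∀ u v → u ≢ v → (Edge G u v ⇔ (R u v ⊎ R v u)))

record Orientation {n : ℕ} (G : Graph n) : Set where
  field
    arc   : Fin n → Fin n → Bool
    arc⊆E : ∀ u v → arc u v ≡ true → Edge G u v
    oneDir : ∀ u v → Edge G u v → arc u v ≡ not (arc v u)
open Orientation public

Arc : ∀ {n} {G : Graph n} → Orientation G → Fin n → Fin n → Set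
Arc O u v = arc O u v ≡ true

_≺[_]_ : ∀ {n} {G : Graph n} → Fin n → Orientation G → Fin n → Set
u ≺[ O ] v = TransClosure (Arc O) u v

Acyclic : ∀ {n} {G : Graph n} → Orientation G → Set
Acyclic {n} O = ∀ (u : Fin n) → u ≺[ O ] u → ⊥

IsTransitiveOrientation : ∀ {n} {G : Graph n} → Orientation G → Set
IsTransitiveOrientation {n} {G} O =
  Acyclic O ×
  (∀ u v → u ≢ v → (Edge G u v ⇔ ((u ≺[ O ] v) ⊎ (v ≺[ O ] u))))

count : ∀ {n} → (Fin n → Bool) → ℕ
count {n} p = sum (map (λ v → if p v then 1 else 0) (allFin n))

outdeg indeg : ∀ {n} {G : Graph n} → Orientation G → Fin n → ℕ
outdeg O v = count (λ u → arc O v u)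
indeg  O v = count (λ u → arc O u v)

-- Squared Euclidean norm of the zonotope vertex
-- (outdeg(v) - indeg(v))_{v ∈ V} corresponding to the orientation.
normSq : ∀ {n} {G : Graph n} → Orientation G → ℕ
normSq {n} O = sum (map (λ v → ∣ outdeg O v - indeg O v ∣ ^ 2) (allFin n))

-- The vertex of Z_G corresponding to the acyclic orientation O has maximal
-- Euclidean distance to the origin among all vertices of Z_G.
HasMaxNorm : ∀ {n} {G : Graph n} → Orientation G → Set
HasMaxNorm {n} {G} O = ∀ (O' : Orientation G) → Acyclic O' → normSq O' ≤ normSq O

IsLinearExtension : ∀ {n} {G : Graph n} → Orientation G → Vec (Fin n) n → Set
IsLinearExtension {n} O f =
  (∀ u v → lookup f u ≡ lookup f v → u ≡ v) ×
  (∀ (i : Fin n) → ∃ λ u → lookup f u ≡ i) ×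
  (∀ u v → u ≺[ O ] v → lookup f u <ᶠ lookup f v)

NumLinExt : ∀ {n} {G : Graph n} → Orientation G → ℕ → Set
NumLinExt {n} O k =
  Σ (List (Vec (Fin n) n)) λ L →
    Unique L × (∀ f → (f ∈ L) ⇔ IsLinearExtension O f) × (length L ≡ k)

HasMaxLinExt : ∀ {n} {G : Graph n} → Orientation G → Set
HasMaxLinExt {n} {G} O =
  ∀ (O' : Orientation G) → Acyclic O' →
    ∀ k k' → NumLinExt O k → NumLinExt O' k' → k' ≤ k

{-# OPTIONS --safe #-}

-- Maximal norm: (out − in)² = deg² − 4·out·in, and Σ out(v)·in(v) counts directed
-- paths u → v → w. In an acyclic orientation every triangle contains exactly one such
-- path, so the norm is a constant of G minus 4 times the number of paths u → v → w with
-- u and w not adjacent; these are absent exactly in the transitive orientations.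
--
-- Linear extensions: write an extension as a word listing the vertices in increasing
-- order. Let < be the order of a transitive orientation. Inserting a vertex x
-- into a word linear for < by inverse promotion (x takes the place of the last letter
-- below it, that letter is reinserted further left in the same way, and the letter that
-- finds nothing below it goes to the front) yields a word linear for <. Inserting the
-- letters of an extension of an arbitrary orientation from right to left is injective:
-- two possible first letters are sources of that orientation, hence non-adjacent, hence
-- incomparable for <, and the promotion chain of a word contains at most one element of
-- an antichain.
module Submission where

open import Defs hiding (sym; irrefl)
import Algebra.Properties.Semiring.Sum
open import Data.Bool using (Bool; true; false; not; if_then_else_)
import Data.Bool.Properties as Bool
open import Data.Empty using (⊥; ⊥-elim)
open import Data.Fin using (Fin; zero; suc; punchOut) renaming (_<_ to _<ᶠ_)
import Data.Fin.Properties as Fin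
open import Data.Fin.Properties using (_≟_)
import Data.List as List
open import Data.List using (List; length)
import Data.List.Membership.Propositional as List
import Data.List.Membership.Propositional.Properties as List
import Data.List.Properties as List
import Data.List.Relation.Unary.All as ListAll
open import Data.List.Relation.Unary.AllPairs using (_∷_)
import Data.List.Relation.Unary.Any as ListAny
import Data.List.Relation.Unary.Any.Properties as List
open import Data.List.Relation.Unary.Unique.Propositional using (Unique)
open import Data.Nat using (ℕ; suc; _+_; _*_; _^_; _≤_; ∣_-_∣; z<s; s<s)
import Data.Nat.ListAction as ListAction
open import Data.Nat.Properties
  using (+-*-semiring; +-cancelʳ-≡; +-cancelˡ-≤; *-cancelˡ-≡; +-identityʳ; *-identityʳ; +-comm; *-comm; m+n≡0⇒m≡0;
         m+n≡0⇒n≡0; m≤m+n; n≤0⇒n≡0; 1+n≰n; ≤-total; m≤n⇒∃[o]m+o≡n; ∣m-m+n∣≡n; ∣-∣-comm; module ≤-Reasoning)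
open import Data.Nat.Tactic.RingSolver using (solve-∀)
open import Data.Product using (Σ; ∃; _×_; _,_; proj₁; proj₂)
open import Data.Sum using (_⊎_; inj₁; inj₂; swap; [_,_]′) renaming (map to ⊎-map)
open import Data.Vec as Vec using (Vec; []; _∷_; tabulate)
open import Data.Vec.Membership.Propositional using (_∈_)
open import Data.Vec.Membership.Propositional.Properties using (∈-lookup)
open import Data.Vec.Properties using (∷-injective; lookup∘tabulate; tabulate∘lookup; tabulate-cong)
open import Data.Vec.Relation.Unary.All as All using (All; []; _∷_)
open import Data.Vec.Relation.Unary.All.Properties using (lookup⁺; lookup⁻; tabulate⁺)
open import Data.Vec.Relation.Unary.AllPairs using (AllPairs; []; _∷_)
import Data.Vec.Relation.Unary.Any as VecAny
open import Data.Vec.Relation.Unary.Any using (here; there)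
import Data.Vec.Relation.Unary.Any.Properties as VecAny
open import Function using (_∘_; flip; _⇔_; Equivalence; mk⇔; Injective)
open import Level using (Level)
open import Relation.Binary using (Rel; IsDecStrictPartialOrder; IsStrictPartialOrder; tri<; tri≈; tri>)
open import Relation.Binary.Construct.Closure.Transitive using ([_]; _∷_; _++_)
open import Relation.Binary.PropositionalEquality
open import Relation.Nullary using (¬_; Dec; yes; no; does; contradiction)

open Algebra.Properties.Semiring.Sum +-*-semiring
  using (sum; sum-syntax; sum-cong-≗; sum-replicate-zero; ∑-distrib-+; ∑-comm; *-distribˡ-sum; *-distribʳ-sum)

-- Inverse promotion

∈⇒All : ∀ {a p} {A : Set a} {P : A → Set p} {k} {xs : Vec A k} →
        (∀ {x} → x ∈ xs → P x) → All P xs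
∈⇒All {xs = xs} f = lookup⁻ (λ i → f (∈-lookup i xs))

module Insertion {a ℓ : Level} {A : Set a} {_<_ : Rel A ℓ}
  (isDSPO : IsDecStrictPartialOrder _≡_ _<_) where

  open IsDecStrictPartialOrder isDSPO using (irrefl; _<?_) renaming (trans to <-trans)

  private
    variable
      k : ℕ
      x x′ y z z′ : A

  Linear : Vec A k → Set _
  Linear = AllPairs (λ u v → ¬ (v < u))

  -- The head `z` is the letter travelling left. If `y < z`, it settles in the place of `y` and `y`
  -- travels on; otherwise it passes `y`.
  shift : A → Vec A (suc k) → Vec A (suc (suc k))
  shift y (z ∷ r) with y <? z
  ... | yes _ = y ∷ z ∷ r
  ... | no  _ = z ∷ y ∷ r

  insert : A → Vec A k → Vec A (suc k)
  insert x []      = x ∷ []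
  insert x (y ∷ t) = shift y (insert x t)

  shift-∈⁺ : ∀ (w : Vec A (suc k)) → x ∈ y ∷ w → x ∈ shift y w
  shift-∈⁺ {y = y} (z ∷ r) x∈ with y <? z
  shift-∈⁺ (z ∷ r) x∈               | yes _ = x∈
  shift-∈⁺ (z ∷ r) (here p)         | no  _ = there (here p)
  shift-∈⁺ (z ∷ r) (there (here p)) | no  _ = here p
  shift-∈⁺ (z ∷ r) (there (there p))| no  _ = there (there p)

  shift-∈⁻ : ∀ (w : Vec A (suc k)) → x ∈ shift y w → x ∈ y ∷ w
  shift-∈⁻ {y = y} (z ∷ r) x∈ with y <? z
  shift-∈⁻ (z ∷ r) x∈               | yes _ = x∈
  shift-∈⁻ (z ∷ r) (here p)         | no  _ = there (here p)
  shift-∈⁻ (z ∷ r) (there (here p)) | no  _ = here p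
  shift-∈⁻ (z ∷ r) (there (there p))| no  _ = there (there p)

  insert-∈⁺ : ∀ (t : Vec A k) → z ∈ x ∷ t → z ∈ insert x t
  insert-∈⁺ []      z∈ = z∈
  insert-∈⁺ (y ∷ t) (here p)          = shift-∈⁺ (insert _ t) (there (insert-∈⁺ t (here p)))
  insert-∈⁺ (y ∷ t) (there (here p))  = shift-∈⁺ (insert _ t) (here p)
  insert-∈⁺ (y ∷ t) (there (there p)) = shift-∈⁺ (insert _ t) (there (insert-∈⁺ t (there p)))

  insert-∈⁻ : ∀ (t : Vec A k) → z ∈ insert x t → z ∈ x ∷ t
  insert-∈⁻ []      z∈ = z∈
  insert-∈⁻ (y ∷ t) z∈ with shift-∈⁻ (insert _ t) z∈
  ... | here p  = there (here p)
  ... | there q with insert-∈⁻ t q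
  ...   | here p  = here p
  ...   | there p = there (there p)

  -- Each exchange replaces the travelling letter by a smaller one. So the letter reaching the front
  -- is `x` itself, never exchanged, or a letter of `t` strictly below `x`.
  insert-head : ∀ x (t : Vec A k) {z r} → insert x t ≡ z ∷ r →
                (z ≡ x × r ≡ t) ⊎ (z < x × z ∈ t)
  insert-head x [] refl = inj₁ (refl , refl)
  insert-head x (y ∷ t) eq with insert x t in eq′
  ... | z ∷ r with y <? z | insert-head x t eq′
  insert-head x (y ∷ t) refl | z ∷ r | yes y<z | inj₁ (refl , _) = inj₂ (y<z , here refl)
  insert-head x (y ∷ t) refl | z ∷ r | yes y<z | inj₂ (z<x , _)  = inj₂ (<-trans y<z z<x , here refl)
  insert-head x (y ∷ t) refl | z ∷ r | no _    | inj₁ (refl , refl) = inj₁ (refl , refl)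
  insert-head x (y ∷ t) refl | z ∷ r | no _    | inj₂ (z<x , z∈t)   = inj₂ (z<x , there z∈t)

  -- `x` is the only letter not controlled by linearity of `y ∷ t`. If `y < z`, then `x < y` is
  -- impossible because `z` is at most `x`. If `z` passes `y` after an exchange, `x < y` would put
  -- the letter `z` of `t` below `y`.
  insert-linear : ∀ x (t : Vec A k) → Linear t → Linear (insert x t)
  insert-linear x []      _          = [] ∷ []
  insert-linear x (y ∷ t) (y≯t ∷ lt) with insert x t in eq | insert-linear x t lt
  ... | z ∷ r | z≯r ∷ lr with y <? z
  ...   | yes y<z = ∈⇒All y≯ ∷ z≯r ∷ lr
    where
    y≯ : ∀ {b} → b ∈ z ∷ r → ¬ (b < y)
    y≯ b∈ b<y with insert-∈⁻ t (subst (_ ∈_) (sym eq) b∈)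
    ... | there b∈t = All.lookup y≯t b∈t b<y
    ... | here refl with insert-head x t eq
    ...   | inj₁ (refl , _) = irrefl refl (<-trans b<y y<z)
    ...   | inj₂ (z<x , _)  = irrefl refl (<-trans z<x (<-trans b<y y<z))
  ...   | no y≮z with insert-head x t eq
  ...     | inj₁ (refl , refl) = (y≮z ∷ z≯r) ∷ y≯t ∷ lr
  ...     | inj₂ (z<x , z∈t)   = (y≮z ∷ z≯r) ∷ ∈⇒All y≯ ∷ lr
    where
    y≯ : ∀ {b} → b ∈ r → ¬ (b < y)
    y≯ b∈ b<y with insert-∈⁻ t (subst (_ ∈_) (sym eq) (there b∈))
    ... | there b∈t = All.lookup y≯t b∈t b<y
    ... | here refl = All.lookup y≯t z∈t (<-trans z<x b<y)

  -- z′ < z rules out z′ ∈ t′, so z′ was never displaced: x′ = z′ < z ≤ x.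
  insert-clash : ∀ (t t′ : Vec A k) {r r′} → insert x t ≡ z ∷ r → insert x′ t′ ≡ z′ ∷ r′ →
                 All (λ v → ¬ (v < z)) t′ → z′ < z → ¬ (x′ < x) → ⊥
  insert-clash t t′ e e′ z≯t′ z′<z x′≮x with insert-head _ t e | insert-head _ t′ e′
  ... | _                | inj₂ (_ , z′∈t′) = All.lookup z≯t′ z′∈t′ z′<z
  ... | inj₁ (refl , _)  | inj₁ (refl , _)  = x′≮x z′<z
  ... | inj₂ (z<x , _)   | inj₁ (refl , _)  = x′≮x (<-trans z′<z z<x)

  -- If both last steps settle, or both pass, the letter `y` can be stripped from each side. A mixed
  -- case forces `y = z′` and `z = y′`, so the travellers `z` and `z′` are comparable; linearity and
  -- `insert-clash` exclude this.
  insert-injective : ∀ x x′ (t t′ : Vec A k) → Linear t → Linear t′ →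
                     ¬ (x < x′) → ¬ (x′ < x) →
                     insert x t ≡ insert x′ t′ → x ≡ x′ × t ≡ t′
  insert-injective x x′ [] [] _ _ _ _ refl = refl , refl
  insert-injective x x′ (y ∷ t) (y′ ∷ t′) (y≯t ∷ lt) (y′≯t′ ∷ lt′) x≮x′ x′≮x eq
    with insert x t in e | insert x′ t′ in e′
  ... | z ∷ r | z′ ∷ r′ with y <? z | y′ <? z′
  ...   | yes _   | yes _ with refl , eq′ ← ∷-injective eq =
            let p , q = insert-injective x x′ t t′ lt lt′ x≮x′ x′≮x (trans e (trans eq′ (sym e′)))
            in p , cong (y ∷_) q
  ...   | no _    | no _ with refl , eq′ ← ∷-injective eq with refl , refl ← ∷-injective eq′ =
            let p , q = insert-injective x x′ t t′ lt lt′ x≮x′ x′≮x (trans e (sym e′))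
            in p , cong (y ∷_) q
  ...   | yes y<z | no _ with refl ← eq = ⊥-elim (insert-clash t t′ e e′ y′≯t′ y<z x′≮x)
  ...   | no _ | yes y′<z′ with refl ← eq = ⊥-elim (insert-clash t′ t e′ e y≯t y′<z′ x≮x′)

  toLinear : Vec A k → Vec A k
  toLinear []      = []
  toLinear (s ∷ w) = insert s (toLinear w)

  toLinear-∈⁺ : ∀ (w : Vec A k) → x ∈ w → x ∈ toLinear w
  toLinear-∈⁺ (s ∷ w) (here p)  = insert-∈⁺ (toLinear w) (here p)
  toLinear-∈⁺ (s ∷ w) (there p) = insert-∈⁺ (toLinear w) (there (toLinear-∈⁺ w p))

  toLinear-∈⁻ : ∀ (w : Vec A k) → x ∈ toLinear w → x ∈ w
  toLinear-∈⁻ (s ∷ w) x∈ with insert-∈⁻ (toLinear w) x∈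
  ... | here p  = here p
  ... | there p = there (toLinear-∈⁻ w p)

  toLinear-linear : ∀ (w : Vec A k) → Linear (toLinear w)
  toLinear-linear []      = []
  toLinear-linear (s ∷ w) = insert-linear s (toLinear w) (toLinear-linear w)

  module _ {ℓ′} {_⟶_ : Rel A ℓ′} (orients : ∀ {u v} → u < v → u ⟶ v ⊎ v ⟶ u) where

    toLinear-injective : ∀ {w w′ : Vec A k} →
                         AllPairs (λ u v → ¬ (v ⟶ u)) w → AllPairs (λ u v → ¬ (v ⟶ u)) w′ →
                         toLinear w ≡ toLinear w′ → w ≡ w′
    toLinear-injective {w = []} {[]} _ _ _ = refl
    toLinear-injective {w = s ∷ w} {s′ ∷ w′} (s↚w ∷ pw) (s′↚w′ ∷ pw′) eq
      = let s≡s′ , eq′ = insert-injective s s′ (toLinear w) (toLinear w′)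
                           (toLinear-linear w) (toLinear-linear w′)
                           (λ s<s′ → incomparable (flip irrefl s<s′) (orients s<s′))
                           (λ s′<s → incomparable (flip irrefl s′<s ∘ sym) (swap (orients s′<s))) eq
        in cong₂ _∷_ s≡s′ (toLinear-injective pw pw′ eq′)
      where
      -- The equal images have the same letters, so distinct `s` and `s′` each occur in the tail of
      -- the other's word; an arc between them would run from a later letter to a first one.
      incomparable : s ≢ s′ → s ⟶ s′ ⊎ s′ ⟶ s → ⊥
      incomparable s≢s′ arc
        with toLinear-∈⁻ (s ∷ w) (subst (s′ ∈_) (sym eq) (toLinear-∈⁺ (s′ ∷ w′) (here refl)))
           | toLinear-∈⁻ (s′ ∷ w′) (subst (s ∈_) eq (toLinear-∈⁺ (s ∷ w) (here refl)))
      ... | here s′≡s   | _         = s≢s′ (sym s′≡s)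
      ... | there _     | here s≡s′ = s≢s′ s≡s′
      ... | there s′∈w  | there s∈w′ with arc
      ...   | inj₁ s⟶s′ = All.lookup s′↚w′ s∈w′ s⟶s′
      ...   | inj₂ s′⟶s = All.lookup s↚w s′∈w s′⟶s

-- Counting linear extensions

Unique-lookup-injective : ∀ {a} {A : Set a} {xs : List A} → Unique xs →
                          Injective _≡_ _≡_ (List.lookup xs)
Unique-lookup-injective (_ ∷ _)    {zero}  {zero}  _  = refl
Unique-lookup-injective (x∉ ∷ _)   {zero}  {suc j} eq = contradiction eq (ListAll.lookup x∉ (List.∈-lookup j))
Unique-lookup-injective (x∉ ∷ _)   {suc i} {zero}  eq = contradiction (sym eq) (ListAll.lookup x∉ (List.∈-lookup i))
Unique-lookup-injective (_ ∷ xs!)  {suc i} {suc j} eq = cong suc (Unique-lookup-injective xs! eq)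

-- A relation is used because the image of an element is built from its membership proof;
-- injectivity can then be stated without such proofs. Positions in `ys` give an injection of index
-- sets.
length-injection : ∀ {a b r} {A : Set a} {B : Set b} (_∼_ : A → B → Set r) {xs : List A} {ys : List B} →
                   Unique xs →
                   (∀ {x} → x List.∈ xs → ∃ λ y → y List.∈ ys × x ∼ y) →
                   (∀ {x x′ y} → x ∼ y → x′ ∼ y → x ≡ x′) →
                   length xs ≤ length ys
length-injection _∼_ {xs} {ys} xs! total injective = Fin.injective⇒≤ index-injective
  where
  image : (i : Fin (length xs)) → ∃ λ y → y List.∈ ys × List.lookup xs i ∼ y
  image i = total (List.∈-lookup i)

  index : Fin (length xs) → Fin (length ys)
  index i = ListAny.index (proj₁ (proj₂ (image i)))

  index-injective : Injective _≡_ _≡_ index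
  index-injective {i} {j} eq with image i | image j
  ... | y , y∈ , xᵢ∼y | y′ , y′∈ , xⱼ∼y′ =
    Unique-lookup-injective xs! (injective xᵢ∼y (subst (_ ∼_) y′≡y xⱼ∼y′))
    where
    open ≡-Reasoning
    y′≡y : y′ ≡ y
    y′≡y = begin
      y′                                    ≡⟨ List.lookup-index y′∈ ⟩
      List.lookup ys (ListAny.index y′∈)    ≡⟨ cong (List.lookup ys) eq ⟨
      List.lookup ys (ListAny.index y∈)     ≡⟨ List.lookup-index y∈ ⟨
      y                                     ∎

-- A missed value `i` could be punched out, leaving an injection from `suc n` points to `n`.
Fin-injective⇒surjective : ∀ {n} (f : Fin n → Fin n) → Injective _≡_ _≡_ f → ∀ i → ∃ λ u → f u ≡ i
Fin-injective⇒surjective {suc n} f f-inj i with Fin.any? (λ u → f u ≟ i)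
... | yes p = p
... | no ¬p = ⊥-elim (1+n≰n (Fin.injective⇒≤ {f = λ u → punchOut (i≢f u)}
                (λ {u} {v} eq → f-inj (Fin.punchOut-injective (i≢f u) (i≢f v) eq))))
  where
  i≢f : ∀ u → i ≢ f u
  i≢f u i≡fu = ¬p (u , sym i≡fu)

AllPairs-lookup : ∀ {a r} {A : Set a} {R : Rel A r} {k} {w : Vec A k} → AllPairs R w →
                  ∀ {i j} → i <ᶠ j → R (Vec.lookup w i) (Vec.lookup w j)
AllPairs-lookup (Rx ∷ _)  {zero}  {suc j} _         = lookup⁺ Rx j
AllPairs-lookup (_ ∷ Rxs) {suc i} {suc j} (s<s i<j) = AllPairs-lookup Rxs i<j

AllPairs-tabulate : ∀ {a r} {A : Set a} {R : Rel A r} {k} {f : Fin k → A} →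
                    (∀ {i j} → i <ᶠ j → R (f i) (f j)) → AllPairs R (tabulate f)
AllPairs-tabulate {k = 0}     _  = []
AllPairs-tabulate {k = suc k} Rf = tabulate⁺ (λ j → Rf z<s) ∷ AllPairs-tabulate (Rf ∘ s<s)

-- w lists the vertices by increasing label f, that is, w = f⁻¹ as a word.
record Enumerates {n : ℕ} (w f : Vec (Fin n) n) : Set where
  constructor _,_
  field
    lookup-position : ∀ u → Vec.lookup w (Vec.lookup f u) ≡ u
    position-lookup : ∀ i → Vec.lookup f (Vec.lookup w i) ≡ i

open Enumerates

Enumerates-sym : ∀ {n} {w f : Vec (Fin n) n} → Enumerates w f → Enumerates f w
Enumerates-sym (p , q) = q , p

Enumerates-injective : ∀ {n} {w f f′ : Vec (Fin n) n} → Enumerates w f → Enumerates w f′ → f ≡ f′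
Enumerates-injective {w = w} {f} {f′} (_ , fw≡) (wf′≡ , _) = begin
  f                      ≡⟨ tabulate∘lookup f ⟨
  tabulate (Vec.lookup f)
    ≡⟨ tabulate-cong (λ u → trans (cong (Vec.lookup f) (sym (wf′≡ u))) (fw≡ (Vec.lookup f′ u))) ⟩
  tabulate (Vec.lookup f′) ≡⟨ tabulate∘lookup f′ ⟩
  f′                     ∎
  where open ≡-Reasoning

-- Orders of transitive orientations, and words of linear extensions.

Edge-sym : ∀ {n} (G : Graph n) {u v} → Edge G u v → Edge G v u
Edge-sym G {u} {v} = trans (Graph.sym G v u)

module _ {n : ℕ} {G : Graph n} where

  arcs-dichotomy : (O : Orientation G) → ∀ {u v} → Edge G u v → Arc O u v ⊎ Arc O v u
  arcs-dichotomy O {u} {v} uv with arc O u v in p | arc O v u in q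
  ... | true  | _     = inj₁ refl
  ... | false | true  = inj₂ refl
  ... | false | false with () ← trans (sym p) (trans (oneDir O u v uv) (cong not q))

  Arc⇒Edge : (O : Orientation G) → ∀ {u v} → Arc O u v → Edge G u v
  Arc⇒Edge O = arc⊆E O _ _

  -- Comparable distinct vertices span an edge, and directing it from `v` to `u` would close a cycle
  -- with the path from `u` to `v`.
  ≺⇒Arc : ∀ (O : Orientation G) → IsTransitiveOrientation O → ∀ {u v} → u ≺[ O ] v → Arc O u v
  ≺⇒Arc O (acyclic , comparable) {u} {v} u≺v with u ≟ v
  ... | yes refl = ⊥-elim (acyclic u u≺v)
  ... | no u≢v with arcs-dichotomy O (Equivalence.from (comparable u v u≢v) (inj₁ u≺v))
  ...   | inj₁ u→v = u→v
  ...   | inj₂ v→u = ⊥-elim (acyclic u (u≺v ++ [ v→u ]))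

  Arc-isDecStrictPartialOrder : ∀ (O : Orientation G) → IsTransitiveOrientation O →
                                IsDecStrictPartialOrder _≡_ (Arc O)
  Arc-isDecStrictPartialOrder O tr@(acyclic , _) = record
    { isStrictPartialOrder = record
      { isEquivalence = isEquivalence
      ; irrefl        = λ { refl u→u → acyclic _ [ u→u ] }
      ; trans         = λ u→v v→w → ≺⇒Arc O tr (u→v ∷ [ v→w ])
      ; <-resp-≈      = resp₂ (Arc O)
      }
    ; _≟_  = _≟_
    ; _<?_ = λ u v → arc O u v Bool.≟ true
    }

  -- The word is the inverse of `f`, read off the surjectivity witnesses. An arc from a later to an
  -- earlier letter would lower the label, against monotonicity.
  enumeration : ∀ (O : Orientation G) f → IsLinearExtension O f →
                ∃ λ w → Enumerates w f × AllPairs (λ u v → ¬ Arc O v u) w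
  enumeration O f (f-inj , f-surj , f-mono) =
    tabulate inv ,
    ((λ u → trans (lookup∘tabulate inv _) (f-inj _ _ (f∘inv _))) ,
     (λ i → trans (cong (Vec.lookup f) (lookup∘tabulate inv i)) (f∘inv i))) ,
    AllPairs-tabulate (λ {i} {j} i<j j→i →
      Fin.<-asym i<j (subst₂ _<ᶠ_ (f∘inv j) (f∘inv i) (f-mono _ _ [ j→i ])))
    where
    inv : Fin n → Fin n
    inv i = proj₁ (f-surj i)

    f∘inv : ∀ i → Vec.lookup f (inv i) ≡ i
    f∘inv i = proj₂ (f-surj i)

  -- Labels are positions in `w`. A word of length `n` containing all `n` vertices has no
  -- repetition; the pigeonhole principle gives this as surjectivity of `f`, whence `f∘w`.
  linearExtension : ∀ (O : Orientation G) → IsTransitiveOrientation O →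
                    ∀ {w} → (∀ u → u ∈ w) → AllPairs (λ u v → ¬ Arc O v u) w →
                    ∃ λ f → Enumerates w f × IsLinearExtension O f
  linearExtension O tr@(acyclic , _) {w} ∈w sorted =
    f , (w∘f , f∘w) , f-inj , (λ i → Vec.lookup w i , f∘w i) , f-mono
    where
    f : Vec (Fin n) n
    f = tabulate (λ u → VecAny.index (∈w u))

    w∘f : ∀ u → Vec.lookup w (Vec.lookup f u) ≡ u
    w∘f u = trans (cong (Vec.lookup w) (lookup∘tabulate _ u)) (sym (VecAny.lookup-index (∈w u)))

    f-inj : ∀ u v → Vec.lookup f u ≡ Vec.lookup f v → u ≡ v
    f-inj u v eq = trans (sym (w∘f u)) (trans (cong (Vec.lookup w) eq) (w∘f v))

    f∘w : ∀ i → Vec.lookup f (Vec.lookup w i) ≡ i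
    f∘w i with u , refl ← Fin-injective⇒surjective (Vec.lookup f) (λ {u} {v} → f-inj u v) i =
      cong (Vec.lookup f) (w∘f u)

    f-mono : ∀ u v → u ≺[ O ] v → Vec.lookup f u <ᶠ Vec.lookup f v
    f-mono u v u≺v with Fin.<-cmp (Vec.lookup f u) (Vec.lookup f v)
    ... | tri< lt _ _ = lt
    ... | tri≈ _ eq _ with refl ← f-inj u v eq = ⊥-elim (acyclic u u≺v)
    ... | tri> _ _ gt = contradiction (subst₂ (Arc O) (sym (w∘f u)) (sym (w∘f v)) (≺⇒Arc O tr u≺v))
                                      (AllPairs-lookup sorted gt)

  transitive⇒maxLinExt : ∀ (O : Orientation G) → IsTransitiveOrientation O → HasMaxLinExt O
  transitive⇒maxLinExt O tr O′ _ _ _ (L , _ , L-spec , refl) (L′ , L′! , L′-spec , refl) =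
    length-injection _∼_ L′! total ∼-injective
    where
    open Insertion (Arc-isDecStrictPartialOrder O tr)

    -- `f′` passes to its word `w`, then to `toLinear w`, then to the labels `f`. The witness keeps
    -- `w` and its sortedness for `toLinear-injective`.
    _∼_ : Vec (Fin n) n → Vec (Fin n) n → Set
    f′ ∼ f = ∃ λ w → Enumerates w f′ × AllPairs (λ u v → ¬ Arc O′ v u) w × Enumerates (toLinear w) f

    total : ∀ {f′} → f′ List.∈ L′ → ∃ λ f → f List.∈ L × f′ ∼ f
    total {f′} f′∈ =
      let w , w-enum , w-sorted = enumeration O′ f′ (Equivalence.to (L′-spec f′) f′∈)
          f , f-enum , f-linExt = linearExtension O tr
            (λ u → toLinear-∈⁺ w (subst (_∈ w) (lookup-position w-enum u) (∈-lookup _ w)))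
            (toLinear-linear w)
      in f , Equivalence.from (L-spec f) f-linExt , w , w-enum , w-sorted , f-enum

    ∼-injective : ∀ {f₁ f₂ f} → f₁ ∼ f → f₂ ∼ f → f₁ ≡ f₂
    ∼-injective (w₁ , e₁ , s₁ , l₁) (w₂ , e₂ , s₂ , l₂)
      -- `toLinear w₁` and `toLinear w₂` are both inverse to `f`, hence equal.
      with refl ← toLinear-injective (arcs-dichotomy O′ ∘ Arc⇒Edge O) s₁ s₂
                    (Enumerates-injective (Enumerates-sym l₁) (Enumerates-sym l₂))
      = Enumerates-injective e₁ e₂

-- Norms of the vertices of the graphical zonotope

sum-allFin : ∀ {n} (f : Fin n → ℕ) → ListAction.sum (List.map f (List.allFin n)) ≡ ∑[ i < n ] f i
sum-allFin {n} f = trans (cong ListAction.sum (List.map-tabulate (λ i → i) f)) (sum-tabulate f)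
  where
  sum-tabulate : ∀ {m} (g : Fin m → ℕ) → ListAction.sum (List.tabulate g) ≡ sum g
  sum-tabulate {0}     g = refl
  sum-tabulate {suc m} g = cong (g zero +_) (sum-tabulate (g ∘ suc))

sum≡0 : ∀ {n} {f : Fin n → ℕ} → (∀ i → f i ≡ 0) → sum f ≡ 0
sum≡0 {n} f≡0 = trans (sum-cong-≗ f≡0) (sum-replicate-zero n)

sum≡0⁻ : ∀ {n} (f : Fin n → ℕ) → sum f ≡ 0 → ∀ i → f i ≡ 0
sum≡0⁻ f eq zero    = m+n≡0⇒m≡0 (f zero) eq
sum≡0⁻ f eq (suc i) = sum≡0⁻ (f ∘ suc) (m+n≡0⇒n≡0 (f zero) eq) i

*-sum : ∀ {m n} (f : Fin m → ℕ) (g : Fin n → ℕ) →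
        sum f * sum g ≡ ∑[ i < m ] ∑[ j < n ] (f i * g j)
*-sum f g = trans (*-distribʳ-sum (sum g) f) (sum-cong-≗ (λ i → *-distribˡ-sum (f i) g))

-- Writing `n` as `m + d` turns the absolute difference into `d`, leaving a polynomial identity.
m≤n⇒∣m-n∣²+4mn≡[m+n]² : ∀ {m n} → m ≤ n → ∣ m - n ∣ ^ 2 + 4 * (m * n) ≡ (m + n) ^ 2
m≤n⇒∣m-n∣²+4mn≡[m+n]² {m} m≤n with d , refl ← m≤n⇒∃[o]m+o≡n m≤n
  rewrite ∣m-m+n∣≡n m d = identity m d
  where
  identity : ∀ m d → d * (d * 1) + 4 * (m * (m + d)) ≡ (m + (m + d)) * ((m + (m + d)) * 1)
  identity = solve-∀

∣m-n∣²+4mn≡[m+n]² : ∀ m n → ∣ m - n ∣ ^ 2 + 4 * (m * n) ≡ (m + n) ^ 2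
∣m-n∣²+4mn≡[m+n]² m n with ≤-total m n
... | inj₁ m≤n = m≤n⇒∣m-n∣²+4mn≡[m+n]² m≤n
... | inj₂ n≤m = begin
  ∣ m - n ∣ ^ 2 + 4 * (m * n) ≡⟨ cong₂ (λ d p → d ^ 2 + 4 * p) (∣-∣-comm m n) (*-comm m n) ⟩
  ∣ n - m ∣ ^ 2 + 4 * (n * m) ≡⟨ m≤n⇒∣m-n∣²+4mn≡[m+n]² n≤m ⟩
  (n + m) ^ 2                 ≡⟨ cong (_^ 2) (+-comm n m) ⟩
  (m + n) ^ 2                 ∎
  where open ≡-Reasoning

-- Sums over triples of vertices.

module _ {n : ℕ} where

  ∑³ : (Fin n → Fin n → Fin n → ℕ) → ℕ
  ∑³ f = ∑[ u < n ] ∑[ v < n ] ∑[ w < n ] f u v w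

  ∑³-cong : ∀ {f g : Fin n → Fin n → Fin n → ℕ} → (∀ u v w → f u v w ≡ g u v w) → ∑³ f ≡ ∑³ g
  ∑³-cong f≡g = sum-cong-≗ λ u → sum-cong-≗ λ v → sum-cong-≗ λ w → f≡g u v w

  ∑³-distrib-+ : ∀ f g → ∑³ (λ u v w → f u v w + g u v w) ≡ ∑³ f + ∑³ g
  ∑³-distrib-+ f g =
    trans (sum-cong-≗ λ u →
             trans (sum-cong-≗ λ v → ∑-distrib-+ (f u v) (g u v))
                   (∑-distrib-+ (λ v → sum (f u v)) (λ v → sum (g u v))))
          (∑-distrib-+ (λ u → ∑[ v < n ] sum (f u v)) (λ u → ∑[ v < n ] sum (g u v)))

  ∑³-swap : ∀ f → ∑³ (λ u v w → f v u w) ≡ ∑³ f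
  ∑³-swap f = ∑-comm (λ u v → sum (f v u))

  ∑³-rotate : ∀ f → ∑³ (λ u v w → f v w u) ≡ ∑³ f
  ∑³-rotate f = trans (∑³-swap (λ u v w → f u w v)) (sum-cong-≗ λ u → ∑-comm (λ v w → f u w v))

  ∑³-cycle : ∀ f → ∑³ (λ u v w → f u v w + f v w u + f w u v) ≡ 3 * ∑³ f
  ∑³-cycle f = begin
    ∑³ (λ u v w → f u v w + f v w u + f w u v)
      ≡⟨ ∑³-distrib-+ (λ u v w → f u v w + f v w u) (λ u v w → f w u v) ⟩
    ∑³ (λ u v w → f u v w + f v w u) + ∑³ (λ u v w → f w u v)
      ≡⟨ cong (_+ ∑³ (λ u v w → f w u v)) (∑³-distrib-+ f (λ u v w → f v w u)) ⟩
    ∑³ f + ∑³ (λ u v w → f v w u) + ∑³ (λ u v w → f w u v)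
      ≡⟨ cong₂ (λ a b → ∑³ f + a + b) (∑³-rotate f) (sym (∑³-rotate (λ u v w → f w u v))) ⟩
    ∑³ f + ∑³ f + ∑³ f
      ≡⟨ triple (∑³ f) ⟩
    3 * ∑³ f ∎
    where
    open ≡-Reasoning
    triple : ∀ a → a + a + a ≡ 3 * a
    triple = solve-∀

  -- The first bracket holds the even permutations of the arguments, the second the odd ones; all
  -- six have the same sum over all triples.
  ∑³-symmetrise : ∀ f → ∑³ (λ u v w → (f u v w + f v w u + f w u v) + (f v u w + f w v u + f u w v))
                        ≡ 6 * ∑³ f
  ∑³-symmetrise f = begin
    _
      ≡⟨ ∑³-distrib-+ (λ u v w → f u v w + f v w u + f w u v)
                      (λ u v w → f v u w + f w v u + f u w v) ⟩
    _
      ≡⟨ cong₂ _+_ (∑³-cycle f) (∑³-cycle (λ u v w → f v u w)) ⟩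
    3 * ∑³ f + 3 * ∑³ (λ u v w → f v u w)
      ≡⟨ cong (λ a → 3 * ∑³ f + 3 * a) (∑³-swap f) ⟩
    3 * ∑³ f + 3 * ∑³ f
      ≡⟨ double (∑³ f) ⟩
    6 * ∑³ f ∎
    where
    open ≡-Reasoning
    double : ∀ a → 3 * a + 3 * a ≡ 6 * a
    double = solve-∀

-- Directed paths of two arcs.

ι : Bool → ℕ
ι b = if b then 1 else 0

ι-not : ∀ b → ι b + ι (not b) ≡ 1
ι-not true  = refl
ι-not false = refl

module _ {n : ℕ} {G : Graph n} (O : Orientation G) where

  private
    A E N : Fin n → Fin n → ℕ
    A u v = ι (arc O u v)
    E u v = ι (adj G u v)
    N u v = ι (not (adj G u v))

  -- Products of indicators, so that `∑³` counts paths. The degenerate case `w = u`, where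
  -- `N u u = 1`, contributes nothing to `inducedPath`: no edge is directed both ways.
  transitivePath inducedPath : Fin n → Fin n → Fin n → ℕ
  transitivePath u v w = A u v * A v w * A u w
  inducedPath    u v w = A u v * A v w * N u w

  transitivePaths inducedPaths : ℕ
  transitivePaths = ∑³ transitivePath
  inducedPaths    = ∑³ inducedPath

  arc+arc≡adj : ∀ u v → A u v + A v u ≡ E u v
  arc+arc≡adj u v with adj G u v in e
  ... | true rewrite oneDir O u v e = trans (+-comm (ι (not (arc O v u))) _) (ι-not (arc O v u))
  ... | false with arc O u v in p | arc O v u in q
  ...   | false | false = refl
  ...   | true  | _     with () ← trans (sym e) (Arc⇒Edge O p)
  ...   | false | true  with () ← trans (sym e) (Edge-sym G (Arc⇒Edge O q))

  outdeg≡sum : ∀ v → outdeg O v ≡ ∑[ u < n ] A v u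
  outdeg≡sum v = sum-allFin (A v)

  indeg≡sum : ∀ v → indeg O v ≡ ∑[ u < n ] A u v
  indeg≡sum v = sum-allFin (λ u → A u v)

  outdeg+indeg≡deg : ∀ v → outdeg O v + indeg O v ≡ sum (E v)
  outdeg+indeg≡deg v = begin
    outdeg O v + indeg O v                       ≡⟨ cong₂ _+_ (outdeg≡sum v) (indeg≡sum v) ⟩
    sum (A v) + sum (λ u → A u v)                ≡⟨ ∑-distrib-+ (A v) (λ u → A u v) ⟨
    sum (λ u → A v u + A u v)                    ≡⟨ sum-cong-≗ (arc+arc≡adj v) ⟩
    sum (E v)                                    ∎
    where open ≡-Reasoning

  module _ (acyclic : Acyclic O) where

    noDirectedTriangle : ∀ u v w → A u v * A v w * A w u ≡ 0
    noDirectedTriangle u v w with arc O u v in p | arc O v w in q | arc O w u in r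
    ... | false | _     | _     = refl
    ... | true  | false | _     = refl
    ... | true  | true  | false = refl
    ... | true  | true  | true  = ⊥-elim (acyclic u (p ∷ q ∷ [ r ]))

    -- The factor `1` becomes `A u w + A w u + N u w`, the three possibilities for the pair `u`,
    -- `w`; the term with `A w u` is a directed triangle and vanishes.
    path-split : ∀ u v w → A u v * A v w ≡ transitivePath u v w + inducedPath u v w
    path-split u v w = begin
      A u v * A v w
        ≡⟨ *-identityʳ _ ⟨
      A u v * A v w * 1
        ≡⟨ cong (A u v * A v w *_) (ι-not (adj G u w)) ⟨
      A u v * A v w * (E u w + N u w)
        ≡⟨ cong (λ e → A u v * A v w * (e + N u w)) (arc+arc≡adj u w) ⟨
      A u v * A v w * (A u w + A w u + N u w)
        ≡⟨ expand (A u v * A v w) (A u w) (A w u) (N u w) ⟩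
      transitivePath u v w + inducedPath u v w + A u v * A v w * A w u
        ≡⟨ cong (transitivePath u v w + inducedPath u v w +_) (noDirectedTriangle u v w) ⟩
      transitivePath u v w + inducedPath u v w + 0
        ≡⟨ +-identityʳ _ ⟩
      transitivePath u v w + inducedPath u v w ∎
      where
      open ≡-Reasoning
      expand : ∀ p a b c → p * (a + b + c) ≡ p * a + p * c + p * b
      expand = solve-∀

    normSq+paths : normSq O + 4 * (transitivePaths + inducedPaths) ≡ ∑[ v < n ] (sum (E v) ^ 2)
    normSq+paths = begin
      normSq O + 4 * (transitivePaths + inducedPaths)
        ≡⟨ cong₂ (λ a b → a + 4 * b) (sum-allFin square) (sym paths) ⟩
      sum square + 4 * sum product
        ≡⟨ cong (sum square +_) (*-distribˡ-sum 4 product) ⟩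
      sum square + sum (λ v → 4 * product v)
        ≡⟨ ∑-distrib-+ square (λ v → 4 * product v) ⟨
      sum (λ v → square v + 4 * product v)
        ≡⟨ sum-cong-≗ (λ v → trans (∣m-n∣²+4mn≡[m+n]² (outdeg O v) (indeg O v))
                                   (cong (_^ 2) (outdeg+indeg≡deg v))) ⟩
      sum (λ v → sum (E v) ^ 2) ∎
      where
      open ≡-Reasoning
      square product : Fin n → ℕ
      square  v = ∣ outdeg O v - indeg O v ∣ ^ 2
      product v = outdeg O v * indeg O v

      paths : sum product ≡ transitivePaths + inducedPaths
      paths = begin
        sum product
          ≡⟨ sum-cong-≗ (λ v → trans (*-comm (outdeg O v) _) (cong₂ _*_ (indeg≡sum v) (outdeg≡sum v))) ⟩
        sum (λ v → sum (λ u → A u v) * sum (A v))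
          ≡⟨ sum-cong-≗ (λ v → *-sum (λ u → A u v) (A v)) ⟩
        ∑³ (λ v u w → A u v * A v w)
          ≡⟨ ∑³-swap (λ u v w → A u v * A v w) ⟩
        ∑³ (λ u v w → A u v * A v w)
          ≡⟨ ∑³-cong path-split ⟩
        ∑³ (λ u v w → transitivePath u v w + inducedPath u v w)
          ≡⟨ ∑³-distrib-+ transitivePath inducedPath ⟩
        transitivePaths + inducedPaths ∎

    -- On the right each factor is a sum of two opposite arcs. Of the eight products, six are the
    -- linear orders of the triangle, each one transitive path, and two are directed triangles,
    -- which vanish. Hence `transitivePaths` depends on `G` only.
    6*transitivePaths : 6 * transitivePaths ≡ ∑³ (λ u v w → E u v * E v w * E u w)
    6*transitivePaths = trans (sym (∑³-symmetrise transitivePath)) (∑³-cong λ u v w → begin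
      orders u v w ≡⟨ trans (+-identityʳ _) (+-identityʳ _) ⟨
      orders u v w + 0 + 0
        ≡⟨ cong₂ (λ a b → orders u v w + a + b) (noDirectedTriangle u v w) (noDirectedTriangle u w v) ⟨
      orders u v w + A u v * A v w * A w u + A u w * A w v * A v u
        ≡⟨ expand (A u v) (A v u) (A v w) (A w v) (A u w) (A w u) ⟨
      (A u v + A v u) * (A v w + A w v) * (A u w + A w u)
        ≡⟨ cong₂ _*_ (cong₂ _*_ (arc+arc≡adj u v) (arc+arc≡adj v w)) (arc+arc≡adj u w) ⟩
      E u v * E v w * E u w ∎)
      where
      open ≡-Reasoning
      orders : Fin n → Fin n → Fin n → ℕ
      orders u v w = (p u v w + p v w u + p w u v) + (p v u w + p w v u + p u w v)
        where p = transitivePath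
      expand : ∀ uv vu vw wv uw wu → (uv + vu) * (vw + wv) * (uw + wu) ≡
               (uv * vw * uw + vw * wu * vu + wu * uv * wv) + (vu * uw * vw + wv * vu * wu + uw * wv * uv)
               + uv * vw * wu + uw * wv * vu
      expand = solve-∀

-- Transitive orientations as the maximisers of the norm.

module _ {n : ℕ} {G : Graph n} where

  -- Comparing two orientations eliminates the constant of `G` without subtraction. Their
  -- `transitivePaths` agree because six times either is the same count in `G`.
  normSq+inducedPaths : ∀ (O O′ : Orientation G) → Acyclic O → Acyclic O′ →
                        normSq O + 4 * inducedPaths O ≡ normSq O′ + 4 * inducedPaths O′
  normSq+inducedPaths O O′ ac ac′ = +-cancelʳ-≡ (4 * transitivePaths O) _ _ (begin
    normSq O + 4 * inducedPaths O + 4 * transitivePaths O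
      ≡⟨ regroup (normSq O) (inducedPaths O) (transitivePaths O) ⟩
    normSq O + 4 * (transitivePaths O + inducedPaths O)
      ≡⟨ trans (normSq+paths O ac) (sym (normSq+paths O′ ac′)) ⟩
    normSq O′ + 4 * (transitivePaths O′ + inducedPaths O′)
      ≡⟨ regroup (normSq O′) (inducedPaths O′) (transitivePaths O′) ⟨
    normSq O′ + 4 * inducedPaths O′ + 4 * transitivePaths O′
      ≡⟨ cong (λ t → normSq O′ + 4 * inducedPaths O′ + 4 * t)
              (*-cancelˡ-≡ (transitivePaths O′) (transitivePaths O) 6
                (trans (6*transitivePaths O′ ac′) (sym (6*transitivePaths O ac)))) ⟩
    normSq O′ + 4 * inducedPaths O′ + 4 * transitivePaths O ∎)
    where
    open ≡-Reasoning
    regroup : ∀ s b t → s + 4 * b + 4 * t ≡ s + 4 * (t + b)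
    regroup = solve-∀

  -- The ends of two consecutive arcs from `u` to `v` to `w` are adjacent, or an induced path would
  -- be counted; an arc from `w` to `u` would close a cycle. So every directed path shrinks to an
  -- arc.
  noInducedPaths⇒transitive : ∀ (O : Orientation G) → Acyclic O → inducedPaths O ≡ 0 → IsTransitiveOrientation O
  noInducedPaths⇒transitive O acyclic none =
    acyclic , λ u v _ → mk⇔
      (λ uv → ⊎-map [_] [_] (arcs-dichotomy O uv))
      [ Arc⇒Edge O ∘ closed , Edge-sym G ∘ Arc⇒Edge O ∘ closed ]′
    where
    Arc-trans : ∀ {u v w} → Arc O u v → Arc O v w → Arc O u w
    Arc-trans {u} {v} {w} uv vw with adj G u w in e | sum≡0⁻ _ (sum≡0⁻ _ (sum≡0⁻ _ none u) v) w
    ... | false | absurd rewrite uv | vw with () ← absurd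
    ... | true  | _ with arcs-dichotomy O e
    ...   | inj₁ uw = uw
    ...   | inj₂ wu = ⊥-elim (acyclic u (uv ∷ vw ∷ [ wu ]))

    closed : ∀ {u v} → u ≺[ O ] v → Arc O u v
    closed [ uv ]     = uv
    closed (uv ∷ v≺w) = Arc-trans uv (closed v≺w)

  transitive⇒noInducedPaths : ∀ (O : Orientation G) → IsTransitiveOrientation O → inducedPaths O ≡ 0
  transitive⇒noInducedPaths O tr = sum≡0 λ u → sum≡0 λ v → sum≡0 λ w → none u v w
    where
    none : ∀ u v w → inducedPath O u v w ≡ 0
    none u v w with arc O u v in uv | arc O v w in vw
    ... | false | _     = refl
    ... | true  | false = refl
    ... | true  | true rewrite Arc⇒Edge O (≺⇒Arc O tr (uv ∷ [ vw ])) = refl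

  transitiveOrientation : IsComparabilityGraph G → Σ (Orientation G) IsTransitiveOrientation
  transitiveOrientation (R , isSPO , comparable) = O , acyclic , λ u v u≢v → mk⇔
      (λ uv → ⊎-map [_] [_] (arcs-dichotomy O uv))
      (λ uv → Equivalence.from (comparable u v u≢v) (⊎-map ≺⇒R ≺⇒R uv))
    where
    open IsStrictPartialOrder isSPO using (irrefl; asym) renaming (trans to R-trans)

    -- `R` comes without a decision procedure: adjacency settles whether distinct `u`, `v` are
    -- comparable, the hypothesis then supplies the direction, and asymmetry refutes the other.
    R? : ∀ u v → Dec (R u v)
    R? u v with u ≟ v
    ... | yes u≡v = no (irrefl u≡v)
    ... | no  u≢v with adj G u v in e
    ...   | false = no λ r → contradiction (trans (sym e) (Equivalence.from (comparable u v u≢v) (inj₁ r))) λ ()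
    ...   | true with Equivalence.to (comparable u v u≢v) e
    ...     | inj₁ r = yes r
    ...     | inj₂ r = no (asym r)

    R⇒≢ : ∀ {u v} → R u v → u ≢ v
    R⇒≢ r u≡v = irrefl u≡v r

    does⇒R : ∀ u v → does (R? u v) ≡ true → R u v
    does⇒R u v d with R? u v
    ... | yes r = r

    O : Orientation G
    O = record
      { arc    = λ u v → does (R? u v)
      ; arc⊆E  = λ u v d → let r = does⇒R u v d in Equivalence.from (comparable u v (R⇒≢ r)) (inj₁ r)
      ; oneDir = oneWay
      }
      where
      oneWay : ∀ u v → Edge G u v → does (R? u v) ≡ not (does (R? v u))
      oneWay u v uv with R? u v | R? v u
      ... | yes r | yes r′ = ⊥-elim (asym r r′)
      ... | yes _ | no _   = refl
      ... | no _  | yes _  = refl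
      ... | no ¬r | no ¬r′ with u ≟ v
      ...   | yes refl = contradiction (trans (sym uv) (Graph.irrefl G u)) λ ()
      ...   | no u≢v with Equivalence.to (comparable u v u≢v) uv
      ...     | inj₁ r  = ⊥-elim (¬r r)
      ...     | inj₂ r′ = ⊥-elim (¬r′ r′)

    ≺⇒R : ∀ {u v} → u ≺[ O ] v → R u v
    ≺⇒R [ uv ]     = does⇒R _ _ uv
    ≺⇒R (uv ∷ v≺w) = R-trans (does⇒R _ _ uv) (≺⇒R v≺w)

    acyclic : Acyclic O
    acyclic u u≺u = irrefl refl (≺⇒R u≺u)

  maxNorm⇔transitive : IsComparabilityGraph G → ∀ (O : Orientation G) → Acyclic O →
                       HasMaxNorm O ⇔ IsTransitiveOrientation O
  maxNorm⇔transitive comparability O acyclic = mk⇔ maximal⇒transitive transitive⇒maximal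
    where
    open ≤-Reasoning

    transitive⇒maximal : IsTransitiveOrientation O → HasMaxNorm O
    transitive⇒maximal tr O′ acyclic′ = begin
      normSq O′                            ≤⟨ m≤m+n _ _ ⟩
      normSq O′ + 4 * inducedPaths O′  ≡⟨ normSq+inducedPaths O′ O acyclic′ acyclic ⟩
      normSq O + 4 * inducedPaths O    ≡⟨ cong (λ b → normSq O + 4 * b) (transitive⇒noInducedPaths O tr) ⟩
      normSq O + 0                         ≡⟨ +-identityʳ _ ⟩
      normSq O                             ∎

    maximal⇒transitive : HasMaxNorm O → IsTransitiveOrientation O
    -- Comparability of `G` enters through the competitor `O⋆`. It has no induced paths, so its norm
    -- exceeds that of `O` by `4 * inducedPaths O`, which maximality forces to be zero.
    maximal⇒transitive maximal with O⋆ , tr⋆@(acyclic⋆ , _) ← transitiveOrientation comparability =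
      noInducedPaths⇒transitive O acyclic
        (*-cancelˡ-≡ (inducedPaths O) 0 4 (n≤0⇒n≡0 (+-cancelˡ-≤ (normSq O) _ _ (begin
        normSq O + 4 * inducedPaths O    ≡⟨ normSq+inducedPaths O O⋆ acyclic acyclic⋆ ⟩
        normSq O⋆ + 4 * inducedPaths O⋆  ≡⟨ cong (λ b → normSq O⋆ + 4 * b) (transitive⇒noInducedPaths O⋆ tr⋆) ⟩
        normSq O⋆ + 0                        ≡⟨ +-identityʳ _ ⟩
        normSq O⋆                            ≤⟨ maximal O⋆ acyclic⋆ ⟩
        normSq O                             ≡⟨ +-identityʳ _ ⟨
        normSq O + 0                         ∎))))

theorem5p3 : (n : ℕ) (G : Graph n) → IsComparabilityGraph G →
    (∀ (O : Orientation G) → Acyclic O → (HasMaxNorm O ⇔ IsTransitiveOrientation O)) ×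
    (∀ (O : Orientation G) → IsTransitiveOrientation O → HasMaxLinExt O)
theorem5p3 n G comparability = maxNorm⇔transitive comparability , transitive⇒maxLinExt
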